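{- Let $k,s,t$ be positive integers with $t\geq 47$. Then $\operatorname{gr}_k(K_s,K_t)\leq 2^{kt}s^{3kt}$.
   Context: A $k$-edge-coloring of $K_n$ assigns to each edge one of $k$ colors (not all colors need be used, and it need not be proper). A subgraph is rainbow if all its edges have distinct colors, and monochromatic if all its edges have the same color. For graphs $G,H$ and a positive integer $k$, the Gallai-Ramsey number $\operatorname{gr}_k(G,H)$ is the minimum integer $n$ such that every $k$-edge-coloring of the complete graph $K_n$ contains a rainbow copy of $G$ or a monochromatic copy of $H$. -}

module Defs where

open import Data.Fin using (Fin)
open import Data.Nat using (ℕ; _≤_)
open import Data.Product using (Σ; _×_)
open import Data.Sum using (_⊎_)
open import Function using (_∘_; _↣_; module Injection)
open import Level using (0ℓ)
open import Relation.Binary using (Rel; Symmetric; Irreflexive)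
open import Relation.Binary.PropositionalEquality using (_≡_; _≢_; sym; ≢-sym)

record Graph : Set₁ where
  field
    order  : ℕ
    Adj    : Rel (Fin order) 0ℓ
    symm   : Symmetric Adj
    irrefl : Irreflexive _≡_ Adj

open Graph public

K : ℕ → Graph
K n = record
  { order  = n
  ; Adj    = _≢_
  ; symm   = ≢-sym
  ; irrefl = λ x≡y x≢y → x≢y x≡y
  }

-- An edge of the complete graph is an unordered pair of distinct vertices.
-- A colouring is therefore a symmetric function on ordered pairs of distinct
-- vertices; irrelevance of the distinctness proof makes the colour depend on
-- the endpoints only.
record EdgeColouring (k n : ℕ) : Set where
  field
    colour     : (u v : Fin n) → .(u ≢ v) → Fin k
    colour-sym : ∀ u v .(u≢v : u ≢ v) → colour u v u≢v ≡ colour v u (u≢v ∘ sym)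

open EdgeColouring public

-- A copy of G in the complete graph on n vertices: every injection of the
-- vertices of G determines one, since all pairs of distinct vertices are edges.
Copy : Graph → ℕ → Set
Copy G n = Fin (order G) ↣ Fin n

SameEdge : ∀ {n} (u v x y : Fin n) → Set
SameEdge u v x y = (u ≡ x × v ≡ y) ⊎ (u ≡ y × v ≡ x)

module _ {k n : ℕ} (c : EdgeColouring k n) (G : Graph) (f : Copy G n) where

  open Injection f using (to; injective)

  edgeColour : ∀ u v → Adj G u v → Fin k
  edgeColour u v uv = colour c (to u) (to v) (λ eq → irrefl G (injective eq) uv)

  Rainbow : Set
  Rainbow = ∀ u v x y (uv : Adj G u v) (xy : Adj G x y) →
            edgeColour u v uv ≡ edgeColour x y xy → SameEdge u v x y

  Monochromatic : Set
  Monochromatic = ∀ u v x y (uv : Adj G u v) (xy : Adj G x y) →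
                  edgeColour u v uv ≡ edgeColour x y xy

GallaiRamseyProperty : (k : ℕ) (G H : Graph) → ℕ → Set
GallaiRamseyProperty k G H n =
  (c : EdgeColouring k n) → Σ (Copy G n) (Rainbow c G) ⊎ Σ (Copy H n) (Monochromatic c H)

-- The relation "gr_k(G,H) = n".  It is a relation rather than a function of k, G
-- and H because existence of the minimum is a theorem (it rests on Ramsey's
-- theorem), so a bound on gr_k(G,H) should assert existence as well.
IsGallaiRamseyNumber : (k : ℕ) (G H : Graph) → ℕ → Set
IsGallaiRamseyNumber k G H n =
  GallaiRamseyProperty k G H n × (∀ m → GallaiRamseyProperty k G H m → n ≤ m)

{-# OPTIONS --safe #-}
module Submission where

-- Put M = 2s³.  If every vertex of an N-vertex colouring has degree at most N/M
-- in each colour, a rainbow K_s is found greedily: a new vertex v is bad if it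
-- repeats an old colour towards some chosen u, or sends the same colour to two
-- chosen vertices u, w.  The first kind is bounded by the degrees; the second by
-- the sum over pairs of chosen vertices of #{z : zu and zw have the same colour},
-- which averaging keeps at most s²N/M when each new vertex is picked.
-- Otherwise some vertex has more than N/M neighbours in one colour, and we pass
-- to that neighbourhood.  From M^(kt) vertices this can be repeated kt times, and
-- by pigeonhole t of the vertices removed have the same colour to all later ones.
-- The least n exists since the defining property is decidable for every n.

open import Defs
open import Data.Nat using (ℕ; zero; suc; _+_; _*_; _^_; _≤_; _<_; z≤n; s≤s; _<?_; NonZero)
open import Data.Nat.Properties hiding (_≟_)
open import Data.Nat.ListAction using (sum)
open import Data.Nat.Tactic.RingSolver using (solve-∀)
open import Data.Bool using (if_then_else_)
open import Data.Nat.Induction using (<-rec)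
open import Data.Empty.Irrelevant using (⊥-elim)
open import Data.Fin using (Fin; zero; suc; _≟_; inject≤; finToFun; funToFin)
import Data.Fin as Fin
open import Data.Fin.Properties using (any?; all?; finToFun-funToFin; inject≤-injective)
import Data.Fin.Properties as Fin
open import Data.Maybe using (Maybe; just; nothing; fromMaybe)
open import Data.Maybe.Properties using (≡-dec; just-injective)
open import Data.List using (List; []; _∷_; map; length; _++_; filter; lookup; allFin)
open import Data.List.Properties using (length-map; length-++; length-tabulate)
open import Data.List.Membership.Propositional using (_∈_; _∉_; find)
open import Data.List.Membership.Propositional.Properties using (∈-filter⁻; ∈-allFin; ∈-lookup; ∈-map⁺; ∈-++⁺ˡ; ∈-++⁺ʳ)
open import Data.List.Relation.Unary.Any as Any using (here; there)
open import Data.List.Relation.Unary.All as All using (All; []; _∷_)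
import Data.List.Relation.Unary.All.Properties as All
open import Data.List.Relation.Unary.AllPairs as AllPairs using (AllPairs; []; _∷_)
import Data.List.Relation.Unary.AllPairs.Properties as AllPairs
open import Data.List.Relation.Unary.Unique.Propositional using (Unique)
import Data.List.Relation.Unary.Unique.Propositional.Properties as Unique
open import Data.Product using (Σ; ∃-syntax; _×_; _,_; proj₁; proj₂)
open import Data.Sum using (_⊎_; inj₁; inj₂)
open import Data.Unit using (⊤; tt)
open import Function using (_∘_; mk↣; module Injection)
open import Function.Definitions using (Injective)
open import Relation.Binary using (DecidableEquality; tri<; tri≈; tri>)
open import Relation.Binary.PropositionalEquality
open import Relation.Nullary using (Dec; yes; no; ¬_; does; contradiction; map′; _×-dec_; _⊎-dec_; _→-dec_)
open import Relation.Unary using (Decidable)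

private variable
  A B P : Set
  k m n : ℕ

-- Finite sums over lists and double counting.

∑ : List A → (A → ℕ) → ℕ
∑ L f = sum (map f L)

syntax ∑ L (λ x → e) = ∑[ x ∈ L ] e

∑-mono-≤ : ∀ (L : List A) {f g} → (∀ {x} → x ∈ L → f x ≤ g x) → ∑ L f ≤ ∑ L g
∑-mono-≤ []      f≤g = z≤n
∑-mono-≤ (x ∷ L) f≤g = +-mono-≤ (f≤g (here refl)) (∑-mono-≤ L (f≤g ∘ there))

∑-const : ∀ (L : List A) d → ∑[ _ ∈ L ] d ≡ length L * d
∑-const []      d = refl
∑-const (x ∷ L) d = cong (d +_) (∑-const L d)

∑-bounded : ∀ (L : List A) {f d} → (∀ {x} → x ∈ L → f x ≤ d) → ∑ L f ≤ length L * d
∑-bounded L {d = d} f≤d = ≤-trans (∑-mono-≤ L f≤d) (≤-reflexive (∑-const L d))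

∑-cong : ∀ (L : List A) {f g} → f ≗ g → ∑ L f ≡ ∑ L g
∑-cong []      f≗g = refl
∑-cong (x ∷ L) f≗g = cong₂ _+_ (f≗g x) (∑-cong L f≗g)

∑-+ : ∀ (L : List A) f g → ∑[ x ∈ L ] (f x + g x) ≡ ∑ L f + ∑ L g
∑-+ []      f g = refl
∑-+ (x ∷ L) f g rewrite ∑-+ L f g = interchange (f x) (g x) (∑ L f) (∑ L g)
  where
  interchange : ∀ a b c d → a + b + (c + d) ≡ a + c + (b + d)
  interchange = solve-∀

∑-* : ∀ (L : List A) m f → ∑[ x ∈ L ] (m * f x) ≡ m * ∑ L f
∑-* []      m f = sym (*-zeroʳ m)
∑-* (x ∷ L) m f rewrite ∑-* L m f = sym (*-distribˡ-+ m (f x) (∑ L f))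

∑-swap : ∀ (L : List A) (M : List B) (f : A → B → ℕ) →
         ∑[ x ∈ L ] ∑[ y ∈ M ] f x y ≡ ∑[ y ∈ M ] ∑[ x ∈ L ] f x y
∑-swap []      M f = sym (trans (∑-const M 0) (*-zeroʳ (length M)))
∑-swap (x ∷ L) M f rewrite ∑-swap L M f = sym (∑-+ M (f x) (λ y → ∑[ z ∈ L ] f z y))

-- The averaging principle behind both `extend` and `pigeonhole`. If `f` is not below `g` at the
-- head, cancelling the head terms leaves a strict inequality for the tail.
∑<∑⇒∃< : ∀ (L : List A) {f g} → ∑ L f < ∑ L g → ∃[ x ] (x ∈ L × f x < g x)
∑<∑⇒∃< (x ∷ L) {f} {g} ∑f<∑g with f x <? g x
... | yes fx<gx = x , here refl , fx<gx
... | no  fx≮gx =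
  let y , y∈L , fy<gy = ∑<∑⇒∃< L (+-cancelˡ-< (g x) _ _
        (≤-<-trans (+-monoˡ-≤ _ (≮⇒≥ fx≮gx)) ∑f<∑g))
  in y , there y∈L , fy<gy

∑≡0⇒All≡0 : ∀ (L : List A) {f} → ∑ L f ≡ 0 → All (λ x → f x ≡ 0) L
∑≡0⇒All≡0 []      ∑≡0 = []
∑≡0⇒All≡0 (x ∷ L) {f} ∑≡0 = m+n≡0⇒m≡0 (f x) ∑≡0 ∷ ∑≡0⇒All≡0 L (m+n≡0⇒n≡0 (f x) ∑≡0)

∑₂ : List A → (A → A → ℕ) → ℕ
∑₂ []       f = 0
∑₂ (x ∷ xs) f = ∑ xs (f x) + ∑₂ xs f

∑-∑₂-swap : ∀ (L : List A) (M : List B) (f : A → B → B → ℕ) →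
            ∑[ x ∈ L ] ∑₂ M (f x) ≡ ∑₂ M (λ y z → ∑[ x ∈ L ] f x y z)
∑-∑₂-swap L []      f = trans (∑-const L 0) (*-zeroʳ (length L))
∑-∑₂-swap L (y ∷ M) f
  rewrite ∑-+ L (λ x → ∑ M (f x y)) (λ x → ∑₂ M (f x))
        | ∑-swap L M (λ x → f x y)
        | ∑-∑₂-swap L M f = refl

∑₂≡0⇒AllPairs≡0 : ∀ (L : List A) {f} → ∑₂ L f ≡ 0 → AllPairs (λ x y → f x y ≡ 0) L
∑₂≡0⇒AllPairs≡0 []      ∑≡0 = []
∑₂≡0⇒AllPairs≡0 (x ∷ L) {f} ∑≡0 =
  ∑≡0⇒All≡0 L (m+n≡0⇒m≡0 (∑ L (f x)) ∑≡0) ∷ ∑₂≡0⇒AllPairs≡0 L (m+n≡0⇒n≡0 (∑ L (f x)) ∑≡0)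

-- Cardinalities are written as sums of indicators, so that double counting becomes an instance of
-- `∑-swap`.
𝟙 : Dec P → ℕ
𝟙 P? = if does P? then 1 else 0

𝟙≡0⇒¬ : (P? : Dec P) → 𝟙 P? ≡ 0 → ¬ P
𝟙≡0⇒¬ (no ¬p) _ = ¬p

∑𝟙≡length-filter : ∀ {P : A → Set} (P? : Decidable P) L → ∑[ x ∈ L ] 𝟙 (P? x) ≡ length (filter P? L)
∑𝟙≡length-filter P? [] = refl
∑𝟙≡length-filter P? (x ∷ L) with P? x
... | yes _ = cong suc (∑𝟙≡length-filter P? L)
... | no  _ = ∑𝟙≡length-filter P? L

-- Greedy construction of rainbow cliques.

-- C is also evaluated on the diagonal, where it will take the value x₀.  Keeping
-- x₀ in the spectrum makes every list of vertices with fresh colours repetition-free.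
module Greedy {A X : Set} (_≟_ : DecidableEquality X) (C : A → A → X)
              (C-sym : ∀ u v → C u v ≡ C v u) (x₀ : X) where

  degree : List A → A → X → ℕ
  degree L v x = ∑[ w ∈ L ] 𝟙 (C v w ≟ x)

  spectrum : List A → List X
  spectrum []       = x₀ ∷ []
  spectrum (v ∷ vs) = map (C v) vs ++ spectrum vs

  RainbowList : List A → Set
  RainbowList []       = ⊤
  RainbowList (v ∷ vs) = All (λ u → C v u ∉ spectrum vs) vs
                       × AllPairs (λ u w → C v u ≢ C v w) vs
                       × RainbowList vs

  -- The exact length is one more than the number of pairs; the square avoids halving and still fits
  -- under the cube needed in `extend`.
  length-spectrum : ∀ vs → length (spectrum vs) ≤ 1 + length vs * length vs
  length-spectrum []       = ≤-refl
  length-spectrum (v ∷ vs)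
    rewrite length-++ (map (C v) vs) {spectrum vs} | length-map (C v) vs = begin
      i + length (spectrum vs)  ≤⟨ +-monoʳ-≤ i (length-spectrum vs) ⟩
      i + (1 + i * i)           ≤⟨ m≤m+n _ (1 + i) ⟩
      i + (1 + i * i) + (1 + i) ≡⟨ expand i ⟩
      1 + (1 + i) * (1 + i)     ∎
    where
    open ≤-Reasoning
    i = length vs
    expand : ∀ i → i + (1 + i * i) + (1 + i) ≡ 1 + (1 + i) * (1 + i)
    expand = solve-∀

  module _ (L : List A) (D : ℕ) (degree≤D : ∀ {v} → v ∈ L → ∀ x → degree L v x ≤ D) where

    codegree : A → A → ℕ
    codegree u w = ∑[ z ∈ L ] 𝟙 (C z u ≟ C z w)

    -- The first term has `C u v` rather than `C v u`, so that summing it over `v` gives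
    -- `degree L u x` as it stands; `conflicts≡0⇒RainbowList` turns it round with `C-sym`.
    conflicts : List A → A → ℕ
    conflicts vs v = ∑[ u ∈ vs ] ∑[ x ∈ spectrum vs ] 𝟙 (C u v ≟ x)
                   + ∑₂ vs (λ u w → 𝟙 (C v u ≟ C v w))

    -- Exchange the sums: a fixed `u` and old colour `x` block `degree L u x` vertices, at most `D`,
    -- and a fixed pair `u`, `w` blocks `codegree u w`.
    ∑-conflicts : ∀ {vs} → All (_∈ L) vs →
      ∑ L (conflicts vs) ≤ length vs * (length (spectrum vs) * D) + ∑₂ vs codegree
    ∑-conflicts {vs} vs⊆L = begin
      ∑ L (conflicts vs)
        ≡⟨ ∑-+ L _ _ ⟩
      ∑[ v ∈ L ] ∑[ u ∈ vs ] ∑[ x ∈ spectrum vs ] 𝟙 (C u v ≟ x)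
        + ∑[ v ∈ L ] ∑₂ vs (λ u w → 𝟙 (C v u ≟ C v w))
        ≡⟨ cong₂ _+_ (trans (∑-swap L vs _) (∑-cong vs (λ u → ∑-swap L (spectrum vs) _)))
                     (∑-∑₂-swap L vs _) ⟩
      ∑[ u ∈ vs ] ∑[ x ∈ spectrum vs ] degree L u x + ∑₂ vs codegree
        ≤⟨ +-monoˡ-≤ _ (∑-bounded vs λ u∈vs → ∑-bounded (spectrum vs) λ {x} _ →
             degree≤D (All.lookup vs⊆L u∈vs) x) ⟩
      length vs * (length (spectrum vs) * D) + ∑₂ vs codegree ∎
      where open ≤-Reasoning

    -- For fixed `u` and `z`, the `v` with `C z v` equal to `C z u` are counted by one degree of
    -- `z`. So an average `v` raises the sum of codegrees over chosen pairs by at most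
    -- `length vs * D`; `extend` allows twice this.
    ∑-codegree : ∀ vs → ∑[ v ∈ L ] ∑[ u ∈ vs ] codegree v u ≤ length vs * (length L * D)
    ∑-codegree vs = begin
      ∑[ v ∈ L ] ∑[ u ∈ vs ] codegree v u ≡⟨ ∑-swap L vs _ ⟩
      ∑[ u ∈ vs ] ∑[ v ∈ L ] codegree v u ≡⟨ ∑-cong vs (λ u → ∑-swap L L _) ⟩
      ∑[ u ∈ vs ] ∑[ z ∈ L ] degree L z (C z u)
        ≤⟨ ∑-bounded vs (λ {u} _ → ∑-bounded L λ {z} z∈L → degree≤D z∈L (C z u)) ⟩
      length vs * (length L * D) ∎
      where open ≤-Reasoning

    conflicts≡0⇒RainbowList : ∀ v vs → conflicts vs v ≡ 0 → RainbowList vs → RainbowList (v ∷ vs)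
    conflicts≡0⇒RainbowList v vs none rb =
        All.map fresh (∑≡0⇒All≡0 vs (m+n≡0⇒m≡0 old none))
      , AllPairs.map (𝟙≡0⇒¬ (_ ≟ _)) (∑₂≡0⇒AllPairs≡0 vs (m+n≡0⇒n≡0 old none))
      , rb
      where
      old = ∑[ u ∈ vs ] ∑[ x ∈ spectrum vs ] 𝟙 (C u v ≟ x)
      fresh : ∀ {u} → ∑[ x ∈ spectrum vs ] 𝟙 (C u v ≟ x) ≡ 0 → C v u ∉ spectrum vs
      fresh {u} ∑≡0 Cvu∈ =
        𝟙≡0⇒¬ (_ ≟ _) (All.lookup (∑≡0⇒All≡0 (spectrum vs) ∑≡0) Cvu∈) (C-sym u v)

    -- With weight W on conflicts, an average of conflicts · W + Σ codegree below W
    -- yields a vertex having no conflict and small codegree at the same time.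
    extend : ∀ {vs} → All (_∈ L) vs → 0 < length L →
      ∑₂ vs codegree ≤ length vs * length vs * D →
      2 * (1 + length vs) ^ 3 * D ≤ length L →
      ∃[ v ] (v ∈ L × conflicts vs v ≡ 0 × ∑ vs (codegree v) ≤ 2 * length vs * D)
    extend {vs} vs⊆L 0<N potential large =
      let v , v∈L , g<W = ∑<∑⇒∃< L {g} ∑g<∑W
      in v , v∈L , noConflict v g<W , m<1+n⇒m≤n (≤-<-trans (m≤n+m _ _) g<W)
      where
      N i W F H : ℕ
      N = length L
      i = length vs
      -- `2 * i * D` is twice the average from `∑-codegree`. The added 1 gives strictness: it lets
      -- `g v < W` mean a codegree sum of at most `2 * i * D`.
      W = 1 + 2 * i * D
      g : A → ℕ
      g v = W * conflicts vs v + ∑ vs (codegree v)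
      F = ∑ L (conflicts vs)
      H = ∑[ v ∈ L ] ∑ vs (codegree v)

      noConflict : ∀ v → g v < W → conflicts vs v ≡ 0
      noConflict v g<W = n<1⇒n≡0 (*-cancelˡ-< W _ _ (≤-<-trans (m≤m+n _ _)
        (<-≤-trans g<W (≤-reflexive (sym (*-identityʳ W))))))

      open ≤-Reasoning

      -- On average there is at most half a conflict per vertex, so conflicts use at most half of
      -- the total budget `N * W`. The codegrees use `i * N * D`, less than the other half.
      2F≤N : 2 * F ≤ N
      2F≤N = begin
        2 * F ≤⟨ *-monoʳ-≤ 2 (∑-conflicts vs⊆L) ⟩
        2 * (i * (length (spectrum vs) * D) + ∑₂ vs codegree)
          ≤⟨ *-monoʳ-≤ 2 (+-mono-≤ (*-monoʳ-≤ i (*-monoˡ-≤ D (length-spectrum vs))) potential) ⟩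
        2 * (i * ((1 + i * i) * D) + i * i * D) ≤⟨ m≤m+n _ _ ⟩
        2 * (i * ((1 + i * i) * D) + i * i * D) + 2 * ((1 + 2 * i + 2 * i * i) * D) ≡⟨ cube i D ⟩
        2 * (1 + i) ^ 3 * D ≤⟨ large ⟩
        N ∎
        where
        cube : ∀ i D → 2 * (i * ((1 + i * i) * D) + i * i * D) + 2 * ((1 + 2 * i + 2 * i * i) * D)
             ≡ 2 * ((1 + i) * ((1 + i) * ((1 + i) * 1))) * D
        cube = solve-∀

      ∑g<∑W : ∑ L g < ∑[ _ ∈ L ] W
      ∑g<∑W = *-cancelˡ-< 2 _ _ (begin-strict
        2 * ∑ L g               ≡⟨ cong (2 *_) (trans (∑-+ L _ _) (cong (_+ H) (∑-* L W _))) ⟩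
        2 * (W * F + H)         ≡⟨ distr W F H ⟩
        W * (2 * F) + 2 * H     ≤⟨ +-mono-≤ (*-monoʳ-≤ W 2F≤N) (*-monoʳ-≤ 2 (∑-codegree vs)) ⟩
        W * N + 2 * (i * (N * D)) <⟨ m<m+n _ 0<N ⟩
        W * N + 2 * (i * (N * D)) + N ≡⟨ regroup i D N ⟩
        2 * (N * W)             ≡⟨ cong (2 *_) (∑-const L W) ⟨
        2 * ∑[ _ ∈ L ] W        ∎)
        where
        distr : ∀ W F H → 2 * (W * F + H) ≡ W * (2 * F) + 2 * H
        distr = solve-∀
        regroup : ∀ i D N → (1 + 2 * i * D) * N + 2 * (i * (N * D)) + N ≡ 2 * (N * (1 + 2 * i * D))
        regroup = solve-∀

    -- The bound on the sum of codegrees is carried along because `extend` needs it at the next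
    -- step. It survives because the increment `2 * i * D` is at most the difference of consecutive
    -- squares times `D`.
    greedy : ∀ s → 0 < length L → 2 * s ^ 3 * D ≤ length L →
      ∃[ vs ] (length vs ≡ s × All (_∈ L) vs × RainbowList vs × ∑₂ vs codegree ≤ s * s * D)
    greedy zero    0<N large = [] , refl , [] , tt , z≤n
    greedy (suc i) 0<N large
      with greedy i 0<N (≤-trans (*-monoˡ-≤ D (*-monoʳ-≤ 2 (^-monoˡ-≤ 3 (n≤1+n i)))) large)
    ... | vs , refl , vs⊆L , rb , potential =
      let v , v∈L , none , small = extend vs⊆L 0<N potential large
      in v ∷ vs , refl , v∈L ∷ vs⊆L , conflicts≡0⇒RainbowList v vs none rb , (begin
        ∑ vs (codegree v) + ∑₂ vs codegree ≤⟨ +-mono-≤ small potential ⟩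
        2 * i * D + i * i * D              ≤⟨ m≤m+n _ D ⟩
        2 * i * D + i * i * D + D          ≡⟨ square i D ⟩
        (1 + i) * (1 + i) * D              ∎)
      where
      open ≤-Reasoning
      square : ∀ i D → 2 * i * D + i * i * D + D ≡ (1 + i) * (1 + i) * D
      square = solve-∀

-- Pigeonhole and indexing into lists.

1≤∑𝟙 : ∀ {x : Fin k} {L} → x ∈ L → 1 ≤ ∑[ y ∈ L ] 𝟙 (x ≟ y)
1≤∑𝟙 {x = x} (here {y} refl) with x ≟ x
... | yes _  = s≤s z≤n
... | no x≢x = contradiction refl x≢x
1≤∑𝟙 (there x∈L) = ≤-trans (1≤∑𝟙 x∈L) (m≤n+m _ _)

pigeonhole : ∀ (f : A → Fin k) L t → k * t < length L →
             ∃[ c ] t < length (filter (λ x → f x ≟ c) L)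
pigeonhole {k = k} f L t kt<N =
  let c , _ , t<∑ = ∑<∑⇒∃< (allFin k) (begin-strict
        ∑[ _ ∈ allFin k ] t                      ≡⟨ ∑-const (allFin k) t ⟩
        length (allFin k) * t                    ≡⟨ cong (_* t) (length-tabulate {n = k} (λ i → i)) ⟩
        k * t                                    <⟨ kt<N ⟩
        length L                                 ≡⟨ *-identityʳ _ ⟨
        length L * 1                             ≡⟨ ∑-const L 1 ⟨
        ∑[ _ ∈ L ] 1                             ≤⟨ ∑-mono-≤ L (λ {x} _ → 1≤∑𝟙 (∈-allFin (f x))) ⟩
        ∑[ x ∈ L ] ∑[ c ∈ allFin k ] 𝟙 (f x ≟ c) ≡⟨ ∑-swap L (allFin k) _ ⟩
        ∑[ c ∈ allFin k ] ∑[ x ∈ L ] 𝟙 (f x ≟ c) ∎)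
  in c , <-≤-trans t<∑ (≤-reflexive (∑𝟙≡length-filter (λ x → f x ≟ c) L))
  where open ≤-Reasoning

AllPairs-lookup : ∀ {R : A → A → Set} {xs} → AllPairs R xs →
                  ∀ {i j} → i Fin.< j → R (lookup xs i) (lookup xs j)
AllPairs-lookup (Rx ∷ _)  {zero}  {suc j} _         = All.lookup Rx (∈-lookup j)
AllPairs-lookup (_ ∷ Rxs) {suc i} {suc j} (s≤s i<j) = AllPairs-lookup Rxs i<j

lookup-injective : ∀ {xs : List A} → Unique xs → ∀ {i j} → lookup xs i ≡ lookup xs j → i ≡ j
lookup-injective xs! {i} {j} eq with Fin.<-cmp i j
... | tri< i<j _ _ = contradiction eq (AllPairs-lookup xs! i<j)
... | tri≈ _ i≡j _ = i≡j
... | tri> _ _ j<i = contradiction (sym eq) (AllPairs-lookup xs! j<i)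

-- Rainbow list or long chain, and cliques from chains.

module PartialColouring {A : Set} {k : ℕ} (C : A → A → Maybe (Fin k))
  (C-sym  : ∀ u v → C u v ≡ C v u)
  (C-diag : ∀ v → C v v ≡ nothing)
  (C-off  : ∀ {u v} → C u v ≡ nothing → u ≡ v) where

  open Greedy (≡-dec _≟_) C C-sym nothing public

  -- The colour is stored beside its vertex so that the pigeonhole principle can be applied to it.
  -- The last entry has no later one, so its stored colour is free.
  Chain : List (A × Fin k) → Set
  Chain = AllPairs (λ e e′ → C (proj₁ e) (proj₁ e′) ≡ just (proj₂ e))

  Clique : Fin k → List A → Set
  Clique c = AllPairs (λ u w → C u w ≡ just c)

  -- Only `v` itself gets `nothing` from `v`. Hence the diagonal value, which `greedy` treats like
  -- any colour, also meets the degree bound as soon as `D` is positive.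
  degree-nothing : ∀ {L} v → Unique L → degree L v nothing ≤ 1
  degree-nothing {L} v L! = ≤-trans (≤-reflexive (∑𝟙≡length-filter P? L))
    (at-most-one (AllPairs.filter⁺ P? L!) (All.all-filter P? L))
    where
    P? = λ w → ≡-dec _≟_ (C v w) nothing
    at-most-one : ∀ {xs} → Unique xs → All (λ w → C v w ≡ nothing) xs → length xs ≤ 1
    at-most-one []                   []               = z≤n
    at-most-one (_ ∷ [])             (_ ∷ [])         = ≤-refl
    at-most-one ((x≢y ∷ _) ∷ _ ∷ _) (vx ∷ vy ∷ _) =
      contradiction (trans (sym (C-off vx)) (C-off vy)) x≢y

  -- Induction on `m` with threshold `D` equal to `(2 * s ^ 3) ^ m`. The size assumption for `suc m`
  -- unfolds to `2 * s ^ 3 * D ≤ length L`, just what `greedy` asks for; and a colour neighbourhood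
  -- larger than `D` satisfies the assumption for `m`.
  rainbow-or-chain : ∀ s .{{_ : NonZero (2 * s ^ 3)}} m {L} → Unique L → (2 * s ^ 3) ^ m ≤ length L →
    (∃[ vs ] (length vs ≡ s × RainbowList vs)) ⊎
    (∃[ es ] (length es ≡ m × All (λ e → proj₁ e ∈ L) es × Chain es))
  rainbow-or-chain s zero    L! large = inj₂ ([] , refl , [] , [])
  rainbow-or-chain s (suc m) {L} L! large
    with Any.any? (λ v → any? (λ c → (2 * s ^ 3) ^ m <? degree L v (just c))) L
  ... | no sparse =
    let vs , len , _ , rb , _ = greedy L D degree≤D s 0<N large in inj₁ (vs , len , rb)
    where
    D = (2 * s ^ 3) ^ m
    0<N : 0 < length L
    0<N = ≤-trans (m^n>0 (2 * s ^ 3) (suc m)) large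
    degree≤D : ∀ {v} → v ∈ L → ∀ x → degree L v x ≤ D
    degree≤D {v} v∈L nothing  = ≤-trans (degree-nothing v L!) (m^n>0 (2 * s ^ 3) m)
    degree≤D     v∈L (just c) = ≮⇒≥ λ dense →
      All.lookup (All.¬Any⇒All¬ L sparse) v∈L (c , dense)
  ... | yes dense
    with v , v∈L , c , D<deg ← find dense
    with rainbow-or-chain s m
           (AllPairs.filter⁺ (λ w → ≡-dec _≟_ (C v w) (just c)) L!)
           (≤-trans (<⇒≤ D<deg) (≤-reflexive (∑𝟙≡length-filter _ L)))
  ... | inj₁ rainbow = inj₁ rainbow
  ... | inj₂ (es , len , es⊆ , chain) =
    -- All later entries come from the filtered list, so `v` has colour `c` to each of them.
    let P? = λ w → ≡-dec _≟_ (C v w) (just c)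
    in inj₂ ( (v , c) ∷ es , cong suc len
            , v∈L ∷ All.map (proj₁ ∘ ∈-filter⁻ P? {xs = L}) es⊆
            , All.map (proj₂ ∘ ∈-filter⁻ P? {xs = L}) es⊆ ∷ chain)

  -- A sublist of a chain is a chain, so entries that store the same colour form a clique in that
  -- colour.
  chain⇒clique : ∀ {es} t → Chain es → k * t < length es →
                 ∃[ c ] ∃[ ws ] (t < length ws × Clique c ws)
  chain⇒clique {es} t chain kt<N =
    let c , t<N = pigeonhole proj₂ es t kt<N
        P? = λ e → proj₂ e ≟ c
    in c , map proj₁ (filter P? es) , <-≤-trans t<N (≤-reflexive (sym (length-map proj₁ (filter P? es))))
     , AllPairs.map⁺ (recolour (AllPairs.filter⁺ P? chain) (All.all-filter P? es))
    where
    recolour : ∀ {es c} → Chain es → All (λ e → proj₂ e ≡ c) es →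
               AllPairs (λ e e′ → C (proj₁ e) (proj₁ e′) ≡ just c) es
    recolour []          []           = []
    recolour (e→ ∷ chain) (refl ∷ es≡c) = e→ ∷ recolour chain es≡c

  -- Rainbow lists and cliques in terms of list positions.

  x₀∈spectrum : ∀ vs → nothing ∈ spectrum vs
  x₀∈spectrum []       = here refl
  x₀∈spectrum (v ∷ vs) = ∈-++⁺ʳ (map (C v) vs) (x₀∈spectrum vs)

  pair∈spectrum : ∀ vs {i j} → i Fin.< j → C (lookup vs i) (lookup vs j) ∈ spectrum vs
  pair∈spectrum (v ∷ vs) {zero}  {suc j} _         = ∈-++⁺ˡ (∈-map⁺ (C v) (∈-lookup {xs = vs} j))
  pair∈spectrum (v ∷ vs) {suc i} {suc j} (s≤s i<j) = ∈-++⁺ʳ (map (C v) vs) (pair∈spectrum vs i<j)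

  RainbowList⇒Unique : ∀ {vs} → RainbowList vs → Unique vs
  RainbowList⇒Unique {[]}     _                = []
  RainbowList⇒Unique {v ∷ vs} (fresh , _ , rb) =
    All.map (λ Cvu∉ v≡u → Cvu∉ (subst (_∈ spectrum vs) (trans (sym (C-diag v)) (cong (C v) v≡u)) (x₀∈spectrum vs))) fresh
    ∷ RainbowList⇒Unique rb

  -- Compare the smaller endpoints. If both edges start at the head, `distinct` separates them; if
  -- only one does, its colour is fresh while the other lies in the spectrum; otherwise recurse.
  rainbow-< : ∀ vs → RainbowList vs → ∀ {i j p q} → i Fin.< j → p Fin.< q →
    C (lookup vs i) (lookup vs j) ≡ C (lookup vs p) (lookup vs q) → i ≡ p × j ≡ q
  rainbow-< (v ∷ vs) (_ , distinct , _) {zero} {suc j} {zero} {suc q} _ _ eq with Fin.<-cmp j q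
  ... | tri< j<q _ _ = contradiction eq (AllPairs-lookup distinct j<q)
  ... | tri≈ _ j≡q _ = refl , cong suc j≡q
  ... | tri> _ _ q<j = contradiction (sym eq) (AllPairs-lookup distinct q<j)
  rainbow-< (v ∷ vs) (fresh , _) {zero} {suc j} {suc p} {suc q} _ (s≤s p<q) eq =
    contradiction (subst (_∈ spectrum vs) (sym eq) (pair∈spectrum vs p<q)) (All.lookup fresh (∈-lookup j))
  rainbow-< (v ∷ vs) (fresh , _) {suc i} {suc j} {zero} {suc q} (s≤s i<j) _ eq =
    contradiction (subst (_∈ spectrum vs) eq (pair∈spectrum vs i<j)) (All.lookup fresh (∈-lookup q))
  rainbow-< (v ∷ vs) (_ , _ , rb) {suc i} {suc j} {suc p} {suc q} (s≤s i<j) (s≤s p<q) eq =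
    let i≡p , j≡q = rainbow-< vs rb i<j p<q eq in cong suc i≡p , cong suc j≡q

  rainbow-≢ : ∀ vs → RainbowList vs → ∀ {i j p q} → i ≢ j → p ≢ q →
    C (lookup vs i) (lookup vs j) ≡ C (lookup vs p) (lookup vs q) → SameEdge i j p q
  rainbow-≢ vs rb {i} {j} {p} {q} i≢j p≢q eq with Fin.<-cmp i j | Fin.<-cmp p q
  ... | tri≈ _ i≡j _ | _            = contradiction i≡j i≢j
  ... | _            | tri≈ _ p≡q _ = contradiction p≡q p≢q
  ... | tri< i<j _ _ | tri< p<q _ _ = inj₁ (rainbow-< vs rb i<j p<q eq)
  ... | tri< i<j _ _ | tri> _ _ q<p = inj₂ (rainbow-< vs rb i<j q<p (trans eq (C-sym _ _)))
  ... | tri> _ _ j<i | tri< p<q _ _ =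
    let j≡p , i≡q = rainbow-< vs rb j<i p<q (trans (C-sym _ _) eq) in inj₂ (i≡q , j≡p)
  ... | tri> _ _ j<i | tri> _ _ q<p =
    let j≡q , i≡p = rainbow-< vs rb j<i q<p (trans (C-sym _ _) (trans eq (C-sym _ _))) in inj₁ (i≡p , j≡q)

  clique-≢ : ∀ {c ws} → Clique c ws → ∀ {i j} → i ≢ j → C (lookup ws i) (lookup ws j) ≡ just c
  clique-≢ clique {i} {j} i≢j with Fin.<-cmp i j
  ... | tri< i<j _ _ = AllPairs-lookup clique i<j
  ... | tri≈ _ i≡j _ = contradiction i≡j i≢j
  ... | tri> _ _ j<i = trans (C-sym _ _) (AllPairs-lookup clique j<i)

  Clique⇒Unique : ∀ {c ws} → Clique c ws → Unique ws
  Clique⇒Unique = AllPairs.map λ {u} Cuw≡c u≡w →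
    contradiction (trans (sym (trans (cong (C u) (sym u≡w)) (C-diag u))) Cuw≡c) λ ()

-- From edge colourings to rainbow and monochromatic copies.

module _ (c : EdgeColouring k n) where

  -- Giving the diagonal a value of its own lets colours be compared without carrying proofs of
  -- distinctness.
  totalColour : Fin n → Fin n → Maybe (Fin k)
  totalColour u v with u ≟ v
  ... | yes _  = nothing
  ... | no u≢v = just (colour c u v u≢v)

  totalColour-≢ : ∀ {u v} .(u≢v : u ≢ v) → totalColour u v ≡ just (colour c u v u≢v)
  totalColour-≢ {u} {v} u≢v with u ≟ v
  ... | yes u≡v = ⊥-elim (u≢v u≡v)
  ... | no _ = refl

  totalColour-diag : ∀ v → totalColour v v ≡ nothing
  totalColour-diag v with v ≟ v
  ... | yes _  = refl
  ... | no v≢v = contradiction refl v≢v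

  totalColour-off : ∀ {u v} → totalColour u v ≡ nothing → u ≡ v
  totalColour-off {u} {v} eq with u ≟ v
  ... | yes u≡v = u≡v

  totalColour-sym : ∀ u v → totalColour u v ≡ totalColour v u
  totalColour-sym u v with u ≟ v
  ... | yes refl = sym (totalColour-diag u)
  ... | no u≢v   = trans (cong just (colour-sym c u v u≢v)) (sym (totalColour-≢ (u≢v ∘ sym)))

  open PartialColouring totalColour totalColour-sym totalColour-diag totalColour-off

  rainbowCopy : ∀ {s vs} → length vs ≡ s → RainbowList vs → Σ (Copy (K s) n) (Rainbow c (K s))
  rainbowCopy {vs = vs} refl rb =
      mk↣ {to = lookup vs} (lookup-injective (RainbowList⇒Unique rb))
    , λ u v x y u≢v x≢y eq → rainbow-≢ vs rb u≢v x≢y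
        (trans (totalColour-≢ _) (trans (cong just eq) (sym (totalColour-≢ _))))

  monochromaticCopy : ∀ {t i ws} → t ≤ length ws → Clique i ws → Σ (Copy (K t) n) (Monochromatic c (K t))
  monochromaticCopy {t} {i} {ws} t≤ clique =
      mk↣ {to = λ x → lookup ws (inject≤ x t≤)} injective
    , λ u v x y u≢v x≢y → just-injective (trans (sym (totalColour-≢ _))
        (trans (mono u≢v) (trans (sym (mono x≢y)) (totalColour-≢ _))))
    where
    injective : ∀ {x y} → lookup ws (inject≤ x t≤) ≡ lookup ws (inject≤ y t≤) → x ≡ y
    injective eq = inject≤-injective t≤ t≤ _ _ (lookup-injective (Clique⇒Unique clique) eq)
    mono : ∀ {x y} → x ≢ y → totalColour (lookup ws (inject≤ x t≤)) (lookup ws (inject≤ y t≤)) ≡ just i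
    mono x≢y = clique-≢ clique (x≢y ∘ inject≤-injective t≤ t≤ _ _)

gallaiRamsey-bound : ∀ k s t → 1 ≤ k → 1 ≤ s → 1 ≤ t →
                     GallaiRamseyProperty k (K s) (K t) ((2 * s ^ 3) ^ (k * t))
gallaiRamsey-bound (suc k) (suc s) (suc t) _ _ _ c
  with rainbow-or-chain (suc s) (suc k * suc t) (Unique.allFin⁺ _)
         (≤-reflexive (sym (length-tabulate (λ i → i))))
  where open PartialColouring (totalColour c) (totalColour-sym c) (totalColour-diag c) (totalColour-off c)
... | inj₁ (_ , len , rb) = inj₁ (rainbowCopy c len rb)
... | inj₂ (es , len , _ , chain) =
  -- The chain has `suc k * suc t` entries, more than `suc k * t`, so some colour is stored more
  -- than `t` times, which is the required clique size `suc t`.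
  let i , ws , t<N , clique = chain⇒clique t chain
        (<-≤-trans (*-monoʳ-< (suc k) (n<1+n t)) (≤-reflexive (sym len)))
  in inj₂ (monochromaticCopy c t<N clique)
  where open PartialColouring (totalColour c) (totalColour-sym c) (totalColour-diag c) (totalColour-off c)

-- Decidability of the Gallai-Ramsey property and least witnesses.

-- `finToFun` reaches each function only up to pointwise equality, hence the condition that `P`
-- respects it.
∃-fun? : ∀ {P : (Fin m → Fin n) → Set} → (∀ {f g} → f ≗ g → P f → P g) → Decidable P → Dec (∃[ f ] P f)
∃-fun? resp P? = map′ (λ (i , p) → finToFun i , p)
  (λ (f , p) → funToFin f , resp (λ x → sym (finToFun-funToFin f x)) p)
  (any? (P? ∘ finToFun))

∀-fun? : ∀ {P : (Fin m → Fin n) → Set} → (∀ {f g} → f ≗ g → P f → P g) → Decidable P → Dec (∀ f → P f)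
∀-fun? resp P? = map′ (λ p f → resp (finToFun-funToFin f) (p (funToFin f)))
  (λ p i → p (finToFun i)) (all? (P? ∘ finToFun))

-- Since `P` takes the proof irrelevantly, a test at one proof settles all of them; for equal `u`
-- and `v` the quantifier is vacuous.
∀≢? : ∀ {u v : Fin n} {P : .(u ≢ v) → Set} → (∀ .u≢v → Dec (P u≢v)) → Dec (∀ (u≢v : u ≢ v) → P u≢v)
∀≢? {u = u} {v} P? with u ≟ v
... | yes u≡v = yes λ u≢v → contradiction u≡v u≢v
... | no u≢v with P? u≢v
...   | yes p = yes λ _ → p
...   | no ¬p = no λ p → ¬p (p u≢v)

least : ∀ {P : ℕ → Set} → Decidable P → ∀ N → P N → ∃[ n ] ((P n × (∀ m → P m → n ≤ m)) × n ≤ N)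
least {P} P? = <-rec _ λ N below pN → case N below pN (anyUpTo? P? N)
  where
  Least : ℕ → Set
  Least N = ∃[ n ] ((P n × (∀ m → P m → n ≤ m)) × n ≤ N)
  case : ∀ N → (∀ {m} → m < N → P m → Least m) → P N → Dec (∃[ m ] (m < N × P m)) → Least N
  case N below pN (no none) = N , (pN , λ m pm → ≮⇒≥ λ m<N → none (m , m<N , pm)) , ≤-refl
  case N below pN (yes (m , m<N , pm)) =
    let n , isLeast , n≤m = below m<N pm in n , isLeast , ≤-trans n≤m (<⇒≤ m<N)

open Injection using (to)

-- A copy contains a proof of injectivity. As `Q` depends only on the underlying map, one proof may
-- replace another, and a search through maps is enough.
copy? : ∀ {s} {Q : Copy (K s) n → Set} → (∀ f g → to f ≗ to g → Q f → Q g) →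
        (∀ f → Dec (Q f)) → Dec (Σ (Copy (K s) n) Q)
copy? {n} {s} {Q} resp Q? = map′
  (λ (_ , inj , q) → mk↣ inj , q)
  (λ (f , q) → to f , (λ {x} {y} → Injection.injective f {x} {y}) , resp _ _ (λ _ → refl) q)
  (∃-fun? transport injectiveWith?)
  where
  InjectiveWith : (Fin s → Fin n) → Set
  InjectiveWith f = Σ (Injective _≡_ _≡_ f) λ inj → Q (mk↣ inj)
  transport : ∀ {f g} → f ≗ g → InjectiveWith f → InjectiveWith g
  transport f≗g (inj , q) = (λ eq → inj (trans (f≗g _) (trans eq (sym (f≗g _))))) , resp _ _ f≗g q
  injectiveWith? : Decidable InjectiveWith
  injectiveWith? f with all? (λ x → all? (λ y → (f x ≟ f y) →-dec (x ≟ y)))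
  ... | no ¬inj = no λ (inj , _) → ¬inj (λ _ _ → inj)
  ... | yes inj = map′ (λ q → (λ {x} {y} → inj x y) , q) (λ (_ , q) → resp _ _ (λ _ → refl) q)
                       (Q? (mk↣ λ {x} {y} → inj x y))

_≈_ : EdgeColouring k n → EdgeColouring k n → Set
c ≈ d = ∀ u v .(u≢v : u ≢ v) → colour c u v u≢v ≡ colour d u v u≢v

module _ (c d : EdgeColouring k n) (c≈d : c ≈ d) (G : Graph) (f g : Copy G n) (f≗g : to f ≗ to g) where

  edgeColour-cong : ∀ u v (uv : Adj G u v) → edgeColour c G f u v uv ≡ edgeColour d G g u v uv
  edgeColour-cong u v uv = trans (c≈d _ _ _) (colour-cong (f≗g u) (f≗g v))
    where
    colour-cong : ∀ {u u′ v v′} → u ≡ u′ → v ≡ v′ → .{u≢v : u ≢ v} .{u′≢v′ : u′ ≢ v′} →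
                  colour d u v u≢v ≡ colour d u′ v′ u′≢v′
    colour-cong refl refl = refl

  Rainbow-resp : Rainbow c G f → Rainbow d G g
  Rainbow-resp rb u v x y uv xy eq = rb u v x y uv xy
    (trans (edgeColour-cong u v uv) (trans eq (sym (edgeColour-cong x y xy))))

  Monochromatic-resp : Monochromatic c G f → Monochromatic d G g
  Monochromatic-resp mono u v x y uv xy =
    trans (sym (edgeColour-cong u v uv)) (trans (mono u v x y uv xy) (edgeColour-cong x y xy))

module _ (c : EdgeColouring k n) {s : ℕ} (f : Copy (K s) n) where

  -- This agrees by computation with `edgeColour` on `K s`, but takes the distinctness proof
  -- irrelevantly, as `∀≢?` demands.
  imageColour : ∀ u v → .(u ≢ v) → Fin k
  imageColour u v u≢v = colour c (to f u) (to f v) (u≢v ∘ Injection.injective f)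

  rainbow? : Dec (Rainbow c (K s) f)
  rainbow? = all? λ u → all? λ v → all? λ x → all? λ y →
    ∀≢? {P = λ u≢v → (x≢y : x ≢ y) → imageColour u v u≢v ≡ imageColour x y x≢y → SameEdge u v x y} λ u≢v →
    ∀≢? {P = λ x≢y → imageColour u v u≢v ≡ imageColour x y x≢y → SameEdge u v x y} λ x≢y →
    (imageColour u v u≢v ≟ imageColour x y x≢y) →-dec
    (((u ≟ x) ×-dec (v ≟ y)) ⊎-dec ((u ≟ y) ×-dec (v ≟ x)))

  monochromatic? : Dec (Monochromatic c (K s) f)
  monochromatic? = all? λ u → all? λ v → all? λ x → all? λ y →
    ∀≢? {P = λ u≢v → (x≢y : x ≢ y) → imageColour u v u≢v ≡ imageColour x y x≢y} λ u≢v →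
    ∀≢? {P = λ x≢y → imageColour u v u≢v ≡ imageColour x y x≢y} λ x≢y →
    imageColour u v u≢v ≟ imageColour x y x≢y

module _ (k s t n : ℕ) where

  Unavoidable : EdgeColouring (suc k) n → Set
  Unavoidable c = Σ (Copy (K s) n) (Rainbow c (K s)) ⊎ Σ (Copy (K t) n) (Monochromatic c (K t))

  Unavoidable-resp : ∀ c d → c ≈ d → Unavoidable c → Unavoidable d
  Unavoidable-resp c d c≈d (inj₁ (f , rb))   = inj₁ (f , Rainbow-resp c d c≈d (K s) f f (λ _ → refl) rb)
  Unavoidable-resp c d c≈d (inj₂ (f , mono)) = inj₂ (f , Monochromatic-resp c d c≈d (K t) f f (λ _ → refl) mono)

  unavoidable? : Decidable Unavoidable
  unavoidable? c = copy? (Rainbow-resp c c (λ _ _ _ → refl) (K s)) (rainbow? c)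
             ⊎-dec copy? (Monochromatic-resp c c (λ _ _ _ → refl) (K t)) (monochromatic? c)

  fromSymmetric : (g : Fin n → Fin n → Fin (suc k)) → (∀ u v → g u v ≡ g v u) → EdgeColouring (suc k) n
  fromSymmetric g g-sym = record { colour = λ u v _ → g u v ; colour-sym = λ u v _ → g-sym u v }

  -- Quantifying over all binary functions and testing symmetry reduces the
  -- decision to functions between finite sets, which finToFun enumerates.
  UnavoidableIfSymmetric : (Fin n → Fin n → Fin (suc k)) → Set
  UnavoidableIfSymmetric g = ∀ g-sym → Unavoidable (fromSymmetric g g-sym)

  unavoidableIfSymmetric? : Decidable UnavoidableIfSymmetric
  unavoidableIfSymmetric? g with all? (λ u → all? (λ v → g u v ≟ g v u))
  ... | no ¬sym = yes λ g-sym → contradiction g-sym ¬sym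
  -- Being unavoidable unfolds to a statement about the colours alone, so the same witness serves
  -- every proof of symmetry.
  ... | yes g-sym = map′ (λ p _ → p) (λ p → p g-sym)
                         (unavoidable? (fromSymmetric g g-sym))

  -- A binary function is coded by its rows, each a number below `suc k ^ n`, so that one use of
  -- `∀-fun?` runs through all of them.
  gallaiRamseyProperty? : Dec (GallaiRamseyProperty (suc k) (K s) (K t) n)
  gallaiRamseyProperty? = map′ decode (λ p h → λ h-sym → p (fromSymmetric _ h-sym))
    (∀-fun? {n = suc k ^ n} {P = λ h → UnavoidableIfSymmetric (λ u → finToFun (h u))} transport
            (λ h → unavoidableIfSymmetric? (λ u → finToFun (h u))))
    where
    transport : ∀ {h h′ : Fin n → Fin (suc k ^ n)} → h ≗ h′ →
      UnavoidableIfSymmetric (λ u → finToFun (h u)) → UnavoidableIfSymmetric (λ u → finToFun (h′ u))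
    transport {h} {h′} h≗h′ p h′-sym =
      Unavoidable-resp (fromSymmetric _ h-sym) (fromSymmetric _ h′-sym) (λ u v _ → eq u v) (p h-sym)
      where
      eq : ∀ u v → finToFun (h u) v ≡ finToFun (h′ u) v
      eq u v = cong (λ i → finToFun i v) (h≗h′ u)
      h-sym : ∀ u v → finToFun (h u) v ≡ finToFun (h v) u
      h-sym u v = trans (eq u v) (trans (h′-sym u v) (sym (eq v u)))

    decode : (∀ h → UnavoidableIfSymmetric (λ u → finToFun (h u))) →
             GallaiRamseyProperty (suc k) (K s) (K t) n
    decode p c = Unavoidable-resp (fromSymmetric _ h-sym) c
      (λ u v u≢v → trans (eq u v) (cong (fromMaybe zero) (totalColour-≢ c u≢v)))
      (p h h-sym)
      where
      g : Fin n → Fin n → Fin (suc k)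
      -- The diagonal is filled with `zero`, available because there are `suc k` colours. Off the
      -- diagonal this is the colour under `c`, and `≈` compares only there.
      g u v = fromMaybe zero (totalColour c u v)
      h : Fin n → Fin (suc k ^ n)
      h u = funToFin (g u)
      eq : ∀ u v → finToFun (h u) v ≡ g u v
      eq u v = finToFun-funToFin (g u) v
      h-sym : ∀ u v → finToFun (h u) v ≡ finToFun (h v) u
      h-sym u v = trans (eq u v) (trans (cong (fromMaybe zero) (totalColour-sym c u v)) (sym (eq v u)))

-- Exponent arithmetic and the final bound.

^-distribʳ-* : ∀ o m n → (m * n) ^ o ≡ m ^ o * n ^ o
^-distribʳ-* zero    m n = refl
^-distribʳ-* (suc o) m n =
  trans (cong (m * n *_) (^-distribʳ-* o m n)) ([m*n]*[o*p]≡[m*o]*[n*p] m n (m ^ o) (n ^ o))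

corollary1p10 : ∀ (k s t : ℕ) → 1 ≤ k → 1 ≤ s → 47 ≤ t →
    ∃[ n ] (IsGallaiRamseyNumber k (K s) (K t) n × n ≤ 2 ^ (k * t) * s ^ (3 * k * t))
corollary1p10 (suc k) s t 1≤k 1≤s 47≤t =
  let n , isLeast , n≤ = least (gallaiRamseyProperty? k s t) ((2 * s ^ 3) ^ (suc k * t))
        (gallaiRamsey-bound (suc k) s t 1≤k 1≤s (≤-trans (s≤s z≤n) 47≤t))
  in n , isLeast , ≤-trans n≤ (≤-reflexive bound≡)
  where
  open ≡-Reasoning
  bound≡ : (2 * s ^ 3) ^ (suc k * t) ≡ 2 ^ (suc k * t) * s ^ (3 * suc k * t)
  bound≡ = begin
    (2 * s ^ 3) ^ (suc k * t)                   ≡⟨ ^-distribʳ-* (suc k * t) 2 (s ^ 3) ⟩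
    2 ^ (suc k * t) * (s ^ 3) ^ (suc k * t)     ≡⟨ cong (2 ^ (suc k * t) *_) (^-*-assoc s 3 (suc k * t)) ⟩
    2 ^ (suc k * t) * s ^ (3 * (suc k * t))     ≡⟨ cong (λ e → 2 ^ (suc k * t) * s ^ e) (*-assoc 3 (suc k) t) ⟨
    2 ^ (suc k * t) * s ^ (3 * suc k * t)       ∎
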